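{- Let $p$ be an odd prime and let $m,n\in\mathbb N_{>0}$. Then $$v_p\left(\sum_{d\mid(m,n)}\mu(d)(-1)^{n/d}\sum_{\substack{0\le a\le n/d\\ p\mid a}}(-1)^a\binom{n/d}{a}\binom{a/p}{m/d}\right)\ge v_p(n)-1.$$ Consequently, if $v_p(n)\ge2$, then $$\sum_{d\mid(m,n)}\mu(d)(-1)^{n/d}\sum_{\substack{0\le a\le n/d\\ p\mid a}}(-1)^a\binom{n/d}{a}\binom{a/p}{m/d}\equiv0\pmod{p^{v_p(n)-1}}.$$
   Context: $v_p$ is the $p$-adic valuation (with $v_p(0)=\infty$), $\mu$ is the Möbius function, and $(m,n)$ denotes the greatest common divisor. -}

module Defs where

open import Data.Bool.Base using (if_then_else_)
open import Data.Fin.Base using (toℕ)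
open import Data.Integer.Base as ℤ using (ℤ; +_; +[1+_]; -[1+_]; 0ℤ; -1ℤ; _-_)
import Data.Integer.Divisibility as ℤ
import Data.Integer.Properties as ℤ
open import Data.List.Base using (List; filter; length; upTo)
open import Data.List.Extrema.Nat using (max)
open import Data.List.Relation.Unary.Any using (any?)
open import Data.Nat.Base using (ℕ; suc; _*_; _^_; _/_; NonZero)
open import Data.Nat.Combinatorics using (_C_)
open import Data.Nat.Divisibility using (_∣?_)
open import Data.Nat.GCD using (gcd)
open import Data.Nat.Primality using (prime?)
open import Relation.Nullary.Construct.Add.Supremum using (_⁺; [_]; ⊤⁺)
open import Relation.Nullary.Decidable using (does; _×-dec_)

open import Algebra.Properties.Semiring.Sum ℤ.+-*-semiring public
  using (sum-syntax; sum⁺-syntax)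
open import Relation.Binary.Construct.Add.Supremum.NonStrict ℤ._≤_ public
  using (_≤⁺_)

-- The largest k with p ^ k ∣ n.  Searching k < n is enough: for p ≥ 2
-- and n ≥ 1, p ^ k ∣ n gives k < p ^ k ≤ n.  Only meaningful for p ≥ 2.
vℕ : (p n : ℕ) .{{_ : NonZero n}} → ℕ
vℕ p n = max 0 (filter (λ k → p ^ k ∣? n) (upTo n))

-- The valuation takes values in ℤ ∪ {∞} rather than ℕ ∪ {∞}, so that it can
-- be compared with integers that may be negative; ⊤⁺ plays the role of ∞.
v : ℕ → ℤ → ℤ ⁺
v p (+ 0)    = ⊤⁺
v p +[1+ n ] = [ + vℕ p (suc n) ]
v p -[1+ n ] = [ + vℕ p (suc n) ]

primeDivisors : (n : ℕ) .{{_ : NonZero n}} → List ℕ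
primeDivisors n = filter (λ q → prime? q ×-dec q ∣? n) (upTo (suc n))

μ : (n : ℕ) .{{_ : NonZero n}} → ℤ
μ n = if does (any? (λ q → q * q ∣? n) (primeDivisors n))
      then 0ℤ
      else -1ℤ ℤ.^ length (primeDivisors n)

-- Sum over the positive divisors d of k, for k ≥ 1.
∑-divisors : (k : ℕ) → ((d : ℕ) .{{_ : NonZero d}} → ℤ) → ℤ
∑-divisors k f =
  ∑[ i < k ] (if does (suc (toℕ i) ∣? k) then f (suc (toℕ i)) else 0ℤ)

syntax ∑-divisors k (λ d → x) = ∑[ d ∣ k ] x

-- Sum over 0 ≤ a ≤ N with p ∣ a.
∑-multiples : (p N : ℕ) → (ℕ → ℤ) → ℤ
∑-multiples p N f =
  ∑[ i ≤ N ] (if does (p ∣? toℕ i) then f (toℕ i) else 0ℤ)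

syntax ∑-multiples p N (λ a → x) = ∑[ p ∣ a ≤ N ] x

S : (p m n : ℕ) .{{_ : NonZero p}} → ℤ
S p m n =
  ∑[ d ∣ gcd m n ]
    (μ d ℤ.* -1ℤ ℤ.^ (n / d) ℤ.*
      ∑[ p ∣ a ≤ n / d ]
        (-1ℤ ℤ.^ a ℤ.* + ((n / d) C a) ℤ.* + ((a / p) C (m / d))))

infix 4 _≡_[mod_]

_≡_[mod_] : ℤ → ℤ → ℕ → Set
x ≡ y [mod k ] = + k ℤ.∣ x - y

-- Put k = v_p(n).  If p^j divides n′ p, then C(n′ p, b p) ≡ C(n′, b) mod p^j,
-- and Σ_b (-1)^b C(n′, b) C(b, M) is (-1)^n′ if n′ = M and 0 otherwise.  For
-- squarefree d ∣ n we have p^(k-1) ∣ n / d, so if k ≥ 2 the d-th summand of S is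
-- modulo p^(k-1) equal to μ(d) if n = m p and to 0 otherwise.  In the first case
-- p ∣ m, hence Σ_{d ∣ m} μ(d) = 0.

module Submission where

open import Defs
open import Data.Bool.Base using (if_then_else_)
open import Data.Bool.Properties using (if-eta; if-float)
open import Data.Fin.Base using (toℕ)
open import Data.Integer.Base as ℤ using (ℤ; +_; 0ℤ; 1ℤ; -1ℤ; _+_; _*_; _-_; -_; ∣_∣)
open import Data.Integer.Divisibility.Signed
  using (divides; ∣ᵤ⇒∣; ∣⇒∣ᵤ; ∣m∣n⇒∣m+n; ∣m⇒∣-m; ∣n⇒∣m*n; ∣m⇒∣m*n)
  renaming (_∣_ to _∣ℤ_)
import Data.Integer.Properties as ℤ
open import Data.Integer.Tactic.RingSolver using (solve-∀)
open import Data.List.Base using (_∷_; length; upTo)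
open import Data.List.Extrema.Nat using (argmax-all; v≤max⁺)
open import Data.List.Membership.Propositional using (_∈_; find; lose)
open import Data.List.Membership.Propositional.Properties
  using (∈-filter⁺; ∈-filter⁻; ∈-upTo⁺)
open import Data.List.Membership.Propositional.Properties.WithK using (unique∧set⇒bag)
open import Data.List.Relation.Binary.BagAndSetEquality using (∼bag⇒↭)
open import Data.List.Relation.Binary.Permutation.Propositional using (_↭_)
open import Data.List.Relation.Binary.Permutation.Propositional.Properties using (↭-length)
open import Data.List.Relation.Unary.All.Properties using (¬Any⇒All¬; all-filter)
open import Data.List.Relation.Unary.Any using (Any; any?; here; there)
open import Data.List.Relation.Unary.Unique.Propositional using (Unique; _∷_)
import Data.List.Relation.Unary.Unique.Propositional.Properties as Unique
open import Data.Nat.Base as ℕ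
  using (ℕ; zero; suc; _≤_; _<_; _^_; _∸_; _/_; NonZero; s≤s; s<s; z<s)
open import Data.Nat.Combinatorics using (_C_; nCk+nC[k+1]≡[n+1]C[k+1]; k>n⇒nCk≡0)
open import Data.Nat.Coprimality using (Coprime; coprime-divisor)
open import Data.Nat.Divisibility as ℕ using (_∣_; _∣?_; divides-refl)
open import Data.Nat.DivMod using (m*n/n≡m; m/n*n≡m)
open import Data.Nat.GCD using (gcd; gcd[m,n]∣m; gcd[m,n]∣n; gcd-greatest)
open import Data.Nat.Primality
  using (Prime; prime?; prime⇒nonZero; prime⇒nonTrivial; prime⇒irreducible; euclidsLemma)
import Data.Nat.Properties as ℕ
open import Data.Product.Base using (_×_; _,_; proj₂)
open import Data.Sum.Base using (inj₁; inj₂)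
open import Function.Base using (_∘_; id)
open import Function.Bundles using (_⇔_; mk⇔)
open import Relation.Binary.Construct.Add.Supremum.NonStrict ℤ._≤_
  using () renaming ([_] to ≤⁺[_]; _≤⊤⁺ to _≤⁺⊤)
open import Relation.Binary.PropositionalEquality
  using (_≡_; refl; sym; trans; cong; cong₂; subst; subst₂; module ≡-Reasoning)
open import Relation.Nullary.Construct.Add.Supremum using ([_])
open import Relation.Nullary.Decidable
  using (Dec; does; yes; no; dec-true; dec-false; does-⇔; _×-dec_)
open import Relation.Nullary.Negation.Core using (¬_; contradiction)

open ≡-Reasoning

-- Sums over initial segments of ℕ

∑< : ℕ → (ℕ → ℤ) → ℤ
∑< n f = ∑[ i < n ] f (toℕ i)

∑<-cong : ∀ n {f g} → (∀ i → i < n → f i ≡ g i) → ∑< n f ≡ ∑< n g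
∑<-cong zero    f≡g = refl
∑<-cong (suc n) f≡g =
  cong₂ _+_ (f≡g 0 z<s) (∑<-cong n λ i i<n → f≡g (suc i) (s<s i<n))

∑<-zero : ∀ n {f} → (∀ i → i < n → f i ≡ 0ℤ) → ∑< n f ≡ 0ℤ
∑<-zero zero    f≡0 = refl
∑<-zero (suc n) f≡0 =
  cong₂ _+_ (f≡0 0 z<s) (∑<-zero n λ i i<n → f≡0 (suc i) (s<s i<n))

∑<-distrib-+ : ∀ n f g → ∑< n (λ i → f i + g i) ≡ ∑< n f + ∑< n g
∑<-distrib-+ zero    f g = refl
∑<-distrib-+ (suc n) f g =
  trans (cong (_+_ (f 0 + g 0)) (∑<-distrib-+ n (f ∘ suc) (g ∘ suc)))
        (interchange (f 0) (g 0) _ _)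
  where
  interchange : ∀ a b c d → (a + b) + (c + d) ≡ (a + c) + (b + d)
  interchange = solve-∀

∑<-distrib-neg : ∀ n f → ∑< n (λ i → - f i) ≡ - ∑< n f
∑<-distrib-neg zero    f = refl
∑<-distrib-neg (suc n) f =
  trans (cong (_+_ (- f 0)) (∑<-distrib-neg n (f ∘ suc)))
        (sym (ℤ.neg-distrib-+ (f 0) _))

∑<-distrib-minus : ∀ n f g → ∑< n (λ i → f i - g i) ≡ ∑< n f - ∑< n g
∑<-distrib-minus n f g =
  trans (∑<-distrib-+ n f (λ i → - g i)) (cong (_+_ (∑< n f)) (∑<-distrib-neg n g))

∑<-++ : ∀ m n f → ∑< (m ℕ.+ n) f ≡ ∑< m f + ∑< n (λ i → f (m ℕ.+ i))
∑<-++ zero    n f = sym (ℤ.+-identityˡ _)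
∑<-++ (suc m) n f =
  trans (cong (_+_ (f 0)) (∑<-++ m n (f ∘ suc))) (sym (ℤ.+-assoc (f 0) _ _))

∑<-last : ∀ n f → ∑< (suc n) f ≡ ∑< n f + f n
∑<-last zero    f = ℤ.+-comm (f 0) 0ℤ
∑<-last (suc n) f =
  trans (cong (_+_ (f 0)) (∑<-last n (f ∘ suc))) (sym (ℤ.+-assoc (f 0) _ _))

∑<-truncate : ∀ {m n f} → m ≤ n → (∀ i → m ≤ i → f i ≡ 0ℤ) → ∑< n f ≡ ∑< m f
∑<-truncate {m} {n} {f} m≤n f≡0 = begin
  ∑< n f                                       ≡⟨ cong (λ k → ∑< k f) (ℕ.m+[n∸m]≡n m≤n) ⟨
  ∑< (m ℕ.+ (n ∸ m)) f                         ≡⟨ ∑<-++ m (n ∸ m) f ⟩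
  ∑< m f + ∑< (n ∸ m) (λ i → f (m ℕ.+ i))      ≡⟨ cong (_+_ (∑< m f)) (∑<-zero (n ∸ m) λ i _ → f≡0 (m ℕ.+ i) (ℕ.m≤m+n m i)) ⟩
  ∑< m f + 0ℤ                                  ≡⟨ ℤ.+-identityʳ _ ⟩
  ∑< m f                                       ∎

-- By induction on n: in the first block of p terms only the one at 0 survives, and the remaining
-- terms form the same kind of sum for f shifted by p. The bounds carry `suc` because both end
-- points 0 and n p count.
∑<-multiples : ∀ p .{{_ : NonZero p}} n f → (∀ i → ¬ p ∣ i → f i ≡ 0ℤ) →
               ∑< (suc (n ℕ.* p)) f ≡ ∑< (suc n) (λ b → f (b ℕ.* p))
∑<-multiples p@(suc r) zero    f f≡0 = refl
∑<-multiples p@(suc r) (suc n) f f≡0 = begin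
  ∑< (suc (p ℕ.+ n ℕ.* p)) f
    ≡⟨ cong (λ k → ∑< k f) (ℕ.+-suc p (n ℕ.* p)) ⟨
  ∑< (p ℕ.+ suc (n ℕ.* p)) f
    ≡⟨ ∑<-++ p _ f ⟩
  (f 0 + ∑< r (f ∘ suc)) + ∑< (suc (n ℕ.* p)) (λ i → f (p ℕ.+ i))
    ≡⟨ cong₂ _+_ (trans (cong (_+_ (f 0)) block≡0) (ℤ.+-identityʳ (f 0))) (∑<-multiples p n _ shifted≡0) ⟩
  f 0 + ∑< (suc n) (λ b → f (p ℕ.+ b ℕ.* p))
    ∎
  where
  block≡0 : ∑< r (f ∘ suc) ≡ 0ℤ
  block≡0 = ∑<-zero r λ i i<r → f≡0 (suc i) (ℕ.>⇒∤ (s<s i<r))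
  shifted≡0 : ∀ i → ¬ p ∣ i → f (p ℕ.+ i) ≡ 0ℤ
  shifted≡0 i p∤i = f≡0 (p ℕ.+ i) λ p∣p+i → p∤i (ℕ.∣m+n∣m⇒∣n p∣p+i ℕ.∣-refl)

-- Congruences

-- A record, so that x and y can be inferred from the type of a congruence.
infix 4 _≡_⟨mod_⟩
record _≡_⟨mod_⟩ (x y k : ℤ) : Set where
  constructor congruent
  field divides-difference : k ∣ℤ x - y
open _≡_⟨mod_⟩

≡⇒mod : ∀ {k x y} → x ≡ y → x ≡ y ⟨mod k ⟩
≡⇒mod {x = x} refl = congruent (divides 0ℤ (ℤ.+-inverseʳ x))

+-mod : ∀ {k x y z w} → x ≡ y ⟨mod k ⟩ → z ≡ w ⟨mod k ⟩ → x + z ≡ y + w ⟨mod k ⟩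
+-mod {k} {x} {y} {z} {w} (congruent k∣x-y) (congruent k∣z-w) =
  congruent (subst (k ∣ℤ_) (regroup x y z w) (∣m∣n⇒∣m+n k∣x-y k∣z-w))
  where
  regroup : ∀ x y z w → (x - y) + (z - w) ≡ (x + z) - (y + w)
  regroup = solve-∀

*-mod : ∀ {k x y z w} → x ≡ y ⟨mod k ⟩ → z ≡ w ⟨mod k ⟩ → x * z ≡ y * w ⟨mod k ⟩
*-mod {k} {x} {y} {z} {w} (congruent k∣x-y) (congruent k∣z-w) =
  congruent (subst (k ∣ℤ_) (regroup x y z w)
    (∣m∣n⇒∣m+n (∣m⇒∣m*n z k∣x-y) (∣n⇒∣m*n y k∣z-w)))
  where
  regroup : ∀ x y z w → (x - y) * z + y * (z - w) ≡ x * z - y * w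
  regroup = solve-∀

neg-mod : ∀ {k x y} → x ≡ y ⟨mod k ⟩ → - x ≡ - y ⟨mod k ⟩
neg-mod {k} {x} {y} (congruent k∣x-y) =
  congruent (subst (k ∣ℤ_) (regroup x y) (∣m⇒∣-m k∣x-y))
  where
  regroup : ∀ x y → - (x - y) ≡ - x - - y
  regroup = solve-∀

∑<-mod : ∀ {k} n {f g} → (∀ i → i < n → f i ≡ g i ⟨mod k ⟩) → ∑< n f ≡ ∑< n g ⟨mod k ⟩
∑<-mod zero    f≡g = ≡⇒mod refl
∑<-mod (suc n) f≡g = +-mod (f≡g 0 z<s) (∑<-mod n λ i i<n → f≡g (suc i) (s<s i<n))

-- Used with the condition that d divides gcd(m, n). The factor c stands outside the `if` because it
-- will be the same for every d.
if-mod : ∀ {k x y c} {B : Set} (b? : Dec B) → (B → x ≡ y * c ⟨mod k ⟩) →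
         (if does b? then x else 0ℤ) ≡ (if does b? then y else 0ℤ) * c ⟨mod k ⟩
if-mod (yes b) x≡yc = x≡yc b
if-mod (no  _) x≡yc = ≡⇒mod refl

-- Induction on k: by Euclid's lemma p divides b, and one factor p cancels from both sides.
prime-power-divisor : ∀ {p} → Prime p → ∀ k a b → ¬ p ∣ a → p ^ k ∣ a ℕ.* b → p ^ k ∣ b
prime-power-divisor     pr zero    a b p∤a h = ℕ.1∣ b
prime-power-divisor {p} pr (suc k) a b p∤a h
  with euclidsLemma a b pr (ℕ.∣-trans (ℕ.m∣m*n (p ^ k)) h)
... | inj₁ p∣a = contradiction p∣a p∤a
... | inj₂ (divides-refl c) = subst (p ^ suc k ∣_) (ℕ.*-comm p c)
  (ℕ.*-monoʳ-∣ p (prime-power-divisor pr k a c p∤a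
    (ℕ.*-cancelˡ-∣ p {{prime⇒nonZero pr}} (subst (p ℕ.* p ^ k ∣_) regroup h))))
  where
  regroup : a ℕ.* (c ℕ.* p) ≡ p ℕ.* (a ℕ.* c)
  regroup = trans (sym (ℕ.*-assoc a c p)) (ℕ.*-comm (a ℕ.* c) p)

-- Binomial coefficients

pascal : ∀ n k → + (suc n C suc k) ≡ + (n C k) + + (n C suc k)
pascal n k = cong +_ (sym (nCk+nC[k+1]≡[n+1]C[k+1] n k))

-- Induction on n: Pascal's rule opens the left side, the hypotheses for k and k + 1 apply, and
-- Pascal's rule closes the right side.
absorption : ∀ n k → + suc k * + (suc n C suc k) ≡ + suc n * + (n C k)
absorption zero    zero    = refl
absorption zero    (suc k) = ℤ.*-zeroʳ (+ suc (suc k))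
absorption (suc n) zero    = begin
  1ℤ * + (suc (suc n) C 1)              ≡⟨ cong (1ℤ *_) (pascal (suc n) 0) ⟩
  1ℤ * (1ℤ + + (suc n C 1))             ≡⟨ ring (+ (suc n C 1)) ⟩
  1ℤ + 1ℤ * + (suc n C 1)               ≡⟨ cong (_+_ (1ℤ)) (absorption n 0) ⟩
  1ℤ + + suc n * 1ℤ                     ≡⟨ cong (_+_ (1ℤ)) (ℤ.*-identityʳ (+ suc n)) ⟩
  + suc (suc n)                         ≡⟨ ℤ.*-identityʳ _ ⟨
  + suc (suc n) * 1ℤ                    ∎
  where
  ring : ∀ x → 1ℤ * (1ℤ + x) ≡ 1ℤ + 1ℤ * x
  ring = solve-∀
absorption (suc n) (suc k) = begin
  (1ℤ + k′) * + (suc (suc n) C suc (suc k))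
    ≡⟨ cong ((1ℤ + k′) *_) (pascal (suc n) (suc k)) ⟩
  (1ℤ + k′) * (c + + (suc n C suc (suc k)))
    ≡⟨ expand k′ c _ ⟩
  c + (k′ * c + (1ℤ + k′) * + (suc n C suc (suc k)))
    ≡⟨ cong (_+_ c) (cong₂ _+_ (absorption n k) (absorption n (suc k))) ⟩
  c + (+ suc n * + (n C k) + + suc n * + (n C suc k))
    ≡⟨ cong (_+_ c) (ℤ.*-distribˡ-+ (+ suc n) (+ (n C k)) (+ (n C suc k))) ⟨
  c + + suc n * (+ (n C k) + + (n C suc k))
    ≡⟨ cong (λ x → c + + suc n * x) (pascal n k) ⟨
  c + + suc n * c
    ≡⟨ collect (+ suc n) c ⟩
  (1ℤ + + suc n) * c
    ∎
  where
  k′ = + suc k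
  c  = + (suc n C suc k)
  expand : ∀ k x y → (1ℤ + k) * (x + y) ≡ x + (k * x + (1ℤ + k) * y)
  expand = solve-∀
  collect : ∀ n x → x + n * x ≡ (1ℤ + n) * x
  collect = solve-∀

-- Valid for all k because the difference is taken in ℤ.
C-step : ∀ n k → + (n C suc k) * + suc k ≡ + (n C k) * (+ n - + k)
C-step n k = begin
  + (n C suc k) * (1ℤ + + k)
    ≡⟨ before (+ (n C k)) (+ (n C suc k)) (+ k) ⟩
  (1ℤ + + k) * (+ (n C k) + + (n C suc k)) - (1ℤ + + k) * + (n C k)
    ≡⟨ cong (λ x → (1ℤ + + k) * x - (1ℤ + + k) * + (n C k)) (pascal n k) ⟨
  (1ℤ + + k) * + (suc n C suc k) - (1ℤ + + k) * + (n C k)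
    ≡⟨ cong (_- (1ℤ + + k) * + (n C k)) (absorption n k) ⟩
  (1ℤ + + n) * + (n C k) - (1ℤ + + k) * + (n C k)
    ≡⟨ after (+ (n C k)) (+ n) (+ k) ⟩
  + (n C k) * (+ n - + k)
    ∎
  where
  before : ∀ c d k → d * (1ℤ + k) ≡ (1ℤ + k) * (c + d) - (1ℤ + k) * c
  before = solve-∀
  after : ∀ c n k → (1ℤ + n) * c - (1ℤ + k) * c ≡ c * (n - k)
  after = solve-∀

-- The product (x + 1)(x + 2)...(x + r). For x = b p and r = p - 1 its factors are the integers
-- strictly between b p and (b + 1) p.
rising : ℕ → ℤ → ℤ
rising zero    x = 1ℤ
rising (suc r) x = rising r x * (x + + suc r)

rising-mod : ∀ {k x y} r → x ≡ y ⟨mod k ⟩ → rising r x ≡ rising r y ⟨mod k ⟩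
rising-mod {k} zero    x≡y = ≡⇒mod refl
rising-mod {k} (suc r) x≡y = *-mod (rising-mod r x≡y) (+-mod x≡y (≡⇒mod refl))

-- `C-step` iterated r + 1 times produces the factors n - a - i for 0 ≤ i ≤ r. Those with i > 0 are
-- written as -(a - n + i), hence the sign. The factor n - a stays apart since it is the one
-- divisible by p when p divides n and a and r = p - 1.
C-steps : ∀ n a r → + (n C (suc r ℕ.+ a)) * rising (suc r) (+ a)
                  ≡ -1ℤ ℤ.^ r * + (n C a) * (+ n - + a) * rising r (+ a - + n)
C-steps n a zero = begin
  + (n C suc a) * (1ℤ * (+ a + 1ℤ))        ≡⟨ cong (λ x → + (n C suc a) * x) (trans (ℤ.*-identityˡ _) (ℤ.+-comm (+ a) 1ℤ)) ⟩
  + (n C suc a) * + suc a                  ≡⟨ C-step n a ⟩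
  + (n C a) * (+ n - + a)                  ≡⟨ ring (+ (n C a)) (+ n - + a) ⟩
  1ℤ * + (n C a) * (+ n - + a) * 1ℤ        ∎
  where
  ring : ∀ x y → x * y ≡ 1ℤ * x * y * 1ℤ
  ring = solve-∀
C-steps n a (suc r) = begin
  + (n C suc b) * (rising (suc r) (+ a) * (+ a + + suc (suc r)))
    ≡⟨ cong (λ x → + (n C suc b) * (rising (suc r) (+ a) * x)) (ℤ.+-comm (+ a) (+ suc (suc r))) ⟩
  + (n C suc b) * (rising (suc r) (+ a) * + suc b)
    ≡⟨ swap (+ (n C suc b)) (rising (suc r) (+ a)) (+ suc b) ⟩
  (+ (n C suc b) * + suc b) * rising (suc r) (+ a)
    ≡⟨ cong (_* rising (suc r) (+ a)) (C-step n b) ⟩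
  (+ (n C b) * (+ n - + b)) * rising (suc r) (+ a)
    ≡⟨ swap′ (+ (n C b)) (+ n - + b) (rising (suc r) (+ a)) ⟩
  (+ (n C b) * rising (suc r) (+ a)) * (+ n - + b)
    ≡⟨ cong₂ _*_ (C-steps n a r) refl ⟩
  (-1ℤ ℤ.^ r * + (n C a) * (+ n - + a) * rising r (+ a - + n)) * (+ n - (+ suc r + + a))
    ≡⟨ ring (-1ℤ ℤ.^ r) (+ (n C a)) (rising r (+ a - + n)) (+ n) (+ a) (+ suc r) ⟩
  -1ℤ * -1ℤ ℤ.^ r * + (n C a) * (+ n - + a) * (rising r (+ a - + n) * (+ a - + n + + suc r))
    ∎
  where
  b = suc r ℕ.+ a
  swap : ∀ x y z → x * (y * z) ≡ (x * z) * y
  swap = solve-∀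
  swap′ : ∀ x y z → (x * y) * z ≡ (x * z) * y
  swap′ = solve-∀
  ring : ∀ s c w n a r → (s * c * (n - a) * w) * (n - (r + a))
                       ≡ -1ℤ * s * c * (n - a) * (w * (a - n + r))
  ring = solve-∀

odd⇒[-1]^≡-1 : ∀ n → ¬ 2 ∣ n → -1ℤ ℤ.^ n ≡ -1ℤ
odd⇒[-1]^≡-1 zero          2∤n = contradiction (2 ℕ.∣0) 2∤n
odd⇒[-1]^≡-1 (suc zero)    2∤n = refl
odd⇒[-1]^≡-1 (suc (suc n)) 2∤n = begin
  -1ℤ * (-1ℤ * -1ℤ ℤ.^ n) ≡⟨ ring (-1ℤ ℤ.^ n) ⟩
  -1ℤ ℤ.^ n               ≡⟨ odd⇒[-1]^≡-1 n (λ 2∣n → 2∤n (ℕ.∣m∣n⇒∣m+n ℕ.∣-refl 2∣n)) ⟩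
  -1ℤ                     ∎
  where
  ring : ∀ x → -1ℤ * (-1ℤ * x) ≡ x
  ring = solve-∀

odd⇒[-1]^[m*n]≡[-1]^m : ∀ m {n} → ¬ 2 ∣ n → -1ℤ ℤ.^ (m ℕ.* n) ≡ -1ℤ ℤ.^ m
odd⇒[-1]^[m*n]≡[-1]^m m {n} 2∤n = begin
  -1ℤ ℤ.^ (m ℕ.* n)  ≡⟨ cong (-1ℤ ℤ.^_) (ℕ.*-comm m n) ⟩
  -1ℤ ℤ.^ (n ℕ.* m)  ≡⟨ ℤ.^-*-assoc -1ℤ n m ⟨
  (-1ℤ ℤ.^ n) ℤ.^ m  ≡⟨ cong (ℤ._^ m) (odd⇒[-1]^≡-1 n 2∤n) ⟩
  -1ℤ ℤ.^ m          ∎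

[-1]^-square : ∀ n → -1ℤ ℤ.^ n * -1ℤ ℤ.^ n ≡ 1ℤ
[-1]^-square zero    = refl
[-1]^-square (suc n) = trans (ring (-1ℤ ℤ.^ n)) ([-1]^-square n)
  where
  ring : ∀ x → (-1ℤ * x) * (-1ℤ * x) ≡ x * x
  ring = solve-∀

-- The product of rising r (c p - N) over the blocks c < b.  With r = p - 1
-- and N = 0 it is the part of (b p)! prime to p.
blocks : (p r : ℕ) → ℤ → ℕ → ℤ
blocks p r N zero    = 1ℤ
blocks p r N (suc b) = blocks p r N b * rising r (+ (b ℕ.* p) - N)

blocks-mod : ∀ {k x y} p r b → x ≡ y ⟨mod k ⟩ → blocks p r x b ≡ blocks p r y b ⟨mod k ⟩
blocks-mod p r zero    x≡y = ≡⇒mod refl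
blocks-mod p r (suc b) x≡y = *-mod (blocks-mod p r b x≡y)
  (rising-mod r (+-mod (≡⇒mod {x = + (b ℕ.* p)} refl) (neg-mod x≡y)))

-- Comparison of C(n p, b p) with C(n, b)

module _ {r : ℕ} (pr : Prime (suc r)) (2∤p : ¬ 2 ∣ suc r) where

  private
    p = suc r

  -- Induction on b. Passing from b p to (b + 1) p takes p steps. The factors (n - b) p and (b + 1)
  -- p account for the step from C(n, b) to C(n, b + 1); the others form the next block on each
  -- side. The sign (-1)^(p - 1) is 1 because p is odd.
  C[n*p,b*p]*blocks : ∀ n b → + ((n ℕ.* p) C (b ℕ.* p)) * blocks p r 0ℤ b
                            ≡ + (n C b) * blocks p r (+ (n ℕ.* p)) b
  C[n*p,b*p]*blocks n zero    = refl
  -- The nonzero factor (b + 1) p completes the block on the left to `rising p (b p)`, so that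
  -- `C-steps` applies.
  C[n*p,b*p]*blocks n (suc b) = ℤ.*-cancelʳ-≡ _ _ (+ suc b * + p) (begin
    + (N C (p ℕ.+ a)) * (Q * rising r (+ a - 0ℤ)) * (+ suc b * + p)
      ≡⟨ cong₂ (λ x y → + (N C (p ℕ.+ a)) * (Q * rising r x) * y) (ℤ.+-identityʳ (+ a))
           (trans (sym (ℤ.pos-* (suc b) p)) (cong +_ (ℕ.+-comm p a))) ⟩
    + (N C (p ℕ.+ a)) * (Q * rising r (+ a)) * (+ a + + p)
      ≡⟨ regroup₁ (+ (N C (p ℕ.+ a))) Q (rising r (+ a)) (+ a + + p) ⟩
    + (N C (p ℕ.+ a)) * (rising r (+ a) * (+ a + + p)) * Q
      ≡⟨ cong (_* Q) (C-steps N a r) ⟩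
    -1ℤ ℤ.^ r * + (N C a) * (+ N - + a) * W * Q
      ≡⟨ cong (λ s → s * + (N C a) * (+ N - + a) * W * Q) [-1]^r≡1 ⟩
    1ℤ * + (N C a) * (+ N - + a) * W * Q
      ≡⟨ regroup₂ (+ (N C a)) (+ N - + a) W Q ⟩
    (+ (N C a) * Q) * ((+ N - + a) * W)
      ≡⟨ cong₂ (λ x y → x * (y * W)) (C[n*p,b*p]*blocks n b)
           (trans (cong₂ _-_ (ℤ.pos-* n p) (ℤ.pos-* b p)) (factor (+ n) (+ b) (+ p))) ⟩
    (+ (n C b) * P) * ((+ n - + b) * + p * W)
      ≡⟨ regroup₃ (+ (n C b)) P (+ n - + b) (+ p) W ⟩
    (+ (n C b) * (+ n - + b)) * (P * W) * + p
      ≡⟨ cong (λ x → x * (P * W) * + p) (C-step n b) ⟨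
    (+ (n C suc b) * + suc b) * (P * W) * + p
      ≡⟨ regroup₄ (+ (n C suc b)) (+ suc b) (P * W) (+ p) ⟩
    + (n C suc b) * (P * W) * (+ suc b * + p)
      ∎)
    where
    N = n ℕ.* p
    a = b ℕ.* p
    Q = blocks p r 0ℤ b
    P = blocks p r (+ N) b
    W = rising r (+ a - + N)
    [-1]^r≡1 : -1ℤ ℤ.^ r ≡ 1ℤ
    [-1]^r≡1 = ℤ.*-cancelˡ-≡ -1ℤ _ _ (odd⇒[-1]^≡-1 p 2∤p)
    regroup₁ : ∀ c q x y → c * (q * x) * y ≡ c * (x * y) * q
    regroup₁ = solve-∀
    regroup₂ : ∀ c d w q → 1ℤ * c * d * w * q ≡ (c * q) * (d * w)
    regroup₂ = solve-∀
    factor : ∀ n b p → n * p - b * p ≡ (n - b) * p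
    factor = solve-∀
    regroup₃ : ∀ c x d p w → (c * x) * (d * p * w) ≡ (c * d) * (x * w) * p
    regroup₃ = solve-∀
    regroup₄ : ∀ c s x p → (c * s) * x * p ≡ c * x * (s * p)
    regroup₄ = solve-∀

  -- Every factor is b p + t with 0 < t < p. The term `- 0ℤ` is what `blocks p r 0ℤ` unfolds to.
  p∤rising : ∀ b i → i < p → ¬ p ∣ ∣ rising i (+ (b ℕ.* p) - 0ℤ) ∣
  p∤rising b zero    i<p p∣ = contradiction (ℕ.∣1⇒≡1 p∣) (ℕ.nonTrivial⇒≢1 {{prime⇒nonTrivial pr}})
  p∤rising b (suc i) i<p p∣
    with euclidsLemma _ _ pr (subst (p ∣_) (ℤ.abs-* (rising i (+ (b ℕ.* p) - 0ℤ)) _) p∣)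
  ... | inj₁ p∣prev = p∤rising b i (ℕ.<-trans (ℕ.n<1+n i) i<p) p∣prev
  ... | inj₂ p∣last = ℕ.>⇒∤ i<p (ℕ.∣m+n∣m⇒∣n
    (subst (λ x → p ∣ ∣ x + + suc i ∣) (ℤ.+-identityʳ (+ (b ℕ.* p))) p∣last) (ℕ.n∣m*n b))

  p∤blocks : ∀ b → ¬ p ∣ ∣ blocks p r 0ℤ b ∣
  p∤blocks zero    p∣ = contradiction (ℕ.∣1⇒≡1 p∣) (ℕ.nonTrivial⇒≢1 {{prime⇒nonTrivial pr}})
  p∤blocks (suc b) p∣
    with euclidsLemma _ _ pr (subst (p ∣_) (ℤ.abs-* (blocks p r 0ℤ b) _) p∣)
  ... | inj₁ p∣prev = p∤blocks b p∣prev
  ... | inj₂ p∣last = p∤rising b r (ℕ.n<1+n r) p∣last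

  C[n*p,b*p]-mod : ∀ j n b → p ^ j ∣ n ℕ.* p →
                   + ((n ℕ.* p) C (b ℕ.* p)) ≡ + (n C b) ⟨mod + (p ^ j) ⟩
  C[n*p,b*p]-mod j n b pʲ∣N = congruent (∣ᵤ⇒∣ (prime-power-divisor pr j _ _ (p∤blocks b)
    (subst (p ^ j ∣_) (ℤ.abs-* Q _) (∣⇒∣ᵤ (subst (+ (p ^ j) ∣ℤ_) eq
      (∣n⇒∣m*n (+ (n C b)) (divides-difference (blocks-mod p r b N≡0))))))))
    where
    Q = blocks p r 0ℤ b
    P = blocks p r (+ (n ℕ.* p)) b
    c = + ((n ℕ.* p) C (b ℕ.* p))
    N≡0 : + (n ℕ.* p) ≡ 0ℤ ⟨mod + (p ^ j) ⟩
    N≡0 = congruent (∣ᵤ⇒∣ (subst (λ x → p ^ j ∣ ∣ x ∣) (sym (ℤ.+-identityʳ (+ (n ℕ.* p)))) pʲ∣N))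
    eq : + (n C b) * (P - Q) ≡ Q * (c - + (n C b))
    eq = begin
      + (n C b) * (P - Q)        ≡⟨ expand (+ (n C b)) P Q ⟩
      + (n C b) * P - + (n C b) * Q ≡⟨ cong (_- + (n C b) * Q) (C[n*p,b*p]*blocks n b) ⟨
      c * Q - + (n C b) * Q      ≡⟨ collect c (+ (n C b)) Q ⟩
      Q * (c - + (n C b))        ∎
      where
      expand : ∀ x y z → x * (y - z) ≡ x * y - x * z
      expand = solve-∀
      collect : ∀ x y z → x * z - y * z ≡ z * (x - y)
      collect = solve-∀

-- Alternating sums

-- The value at 0 of (1 - E)^n g, where E is the shift sending g to `g ∘ suc`.
alternating : ℕ → (ℕ → ℤ) → ℤ
alternating n g = ∑< (suc n) (λ b → -1ℤ ℤ.^ b * + (n C b) * g b)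

alternating-suc : ∀ n g → alternating (suc n) g ≡ alternating n g - alternating n (g ∘ suc)
alternating-suc n g = begin
  t 0 + ∑< (suc n) (λ b → -1ℤ ℤ.^ suc b * + (suc n C suc b) * g (suc b))
    ≡⟨ cong (_+_ (t 0)) (∑<-cong (suc n) λ b _ → step b) ⟩
  t 0 + ∑< (suc n) (λ b → t (suc b) - u b)
    ≡⟨ cong (_+_ (t 0)) (∑<-distrib-minus (suc n) (t ∘ suc) u) ⟩
  t 0 + (∑< (suc n) (t ∘ suc) - ∑< (suc n) u)
    ≡⟨ ℤ.+-assoc (t 0) _ _ ⟨
  ∑< (suc (suc n)) t - alternating n (g ∘ suc)
    -- The term of index n + 1 drops out, as C(n, n + 1) = 0.
    ≡⟨ cong (_- alternating n (g ∘ suc)) (∑<-truncate (ℕ.n≤1+n (suc n)) t≡0) ⟩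
  alternating n g - alternating n (g ∘ suc)
    ∎
  where
  t u : ℕ → ℤ
  t b = -1ℤ ℤ.^ b * + (n C b) * g b
  u b = -1ℤ ℤ.^ b * + (n C b) * g (suc b)
  step : ∀ b → -1ℤ ℤ.^ suc b * + (suc n C suc b) * g (suc b) ≡ t (suc b) - u b
  step b = trans (cong (λ x → -1ℤ ℤ.^ suc b * x * g (suc b)) (pascal n b))
                 (ring (-1ℤ ℤ.^ b) (+ (n C b)) (+ (n C suc b)) (g (suc b)))
    where
    ring : ∀ s c d g → -1ℤ * s * (c + d) * g ≡ -1ℤ * s * d * g - s * c * g
    ring = solve-∀
  t≡0 : ∀ b → n < b → t b ≡ 0ℤ
  t≡0 b n<b = begin
    -1ℤ ℤ.^ b * + (n C b) * g b  ≡⟨ cong (λ c → -1ℤ ℤ.^ b * + c * g b) (k>n⇒nCk≡0 n<b) ⟩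
    -1ℤ ℤ.^ b * 0ℤ * g b         ≡⟨ cong (_* g b) (ℤ.*-zeroʳ (-1ℤ ℤ.^ b)) ⟩
    0ℤ                           ∎

δ : ℕ → ℕ → ℤ
δ m n = if does (m ℕ.≟ n) then 1ℤ else 0ℤ

-- The operator 1 - E kills constants and sends C(b, m + 1) to -C(b, m), so n applications,
-- evaluated at 0, leave (-1)^n if n = m and 0 otherwise.
alternating-C : ∀ n m → alternating n (λ b → + (b C m)) ≡ -1ℤ ℤ.^ n * δ n m
alternating-C zero    zero    = refl
alternating-C zero    (suc m) = refl
alternating-C (suc n) zero    = begin
  alternating (suc n) (λ _ → 1ℤ)                        ≡⟨ alternating-suc n (λ _ → 1ℤ) ⟩
  alternating n (λ _ → 1ℤ) - alternating n (λ _ → 1ℤ)   ≡⟨ ℤ.+-inverseʳ (alternating n (λ _ → 1ℤ)) ⟩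
  0ℤ                                                    ≡⟨ ℤ.*-zeroʳ (-1ℤ ℤ.^ suc n) ⟨
  -1ℤ ℤ.^ suc n * 0ℤ                                    ∎
alternating-C (suc n) (suc m) = begin
  alternating (suc n) g₁
    ≡⟨ alternating-suc n g₁ ⟩
  alternating n g₁ - alternating n (g₁ ∘ suc)
    ≡⟨ cong (_-_ (alternating n g₁)) (trans
         (∑<-cong (suc n) λ b _ → trans (cong (_*_ (-1ℤ ℤ.^ b * + (n C b))) (pascal b m))
                                        (ℤ.*-distribˡ-+ (-1ℤ ℤ.^ b * + (n C b)) (g₀ b) (g₁ b)))
         (∑<-distrib-+ (suc n) (λ b → -1ℤ ℤ.^ b * + (n C b) * g₀ b) (λ b → -1ℤ ℤ.^ b * + (n C b) * g₁ b))) ⟩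
  alternating n g₁ - (alternating n g₀ + alternating n g₁)
    ≡⟨ cancel (alternating n g₁) (alternating n g₀) ⟩
  -1ℤ * alternating n g₀
    ≡⟨ cong (_*_ -1ℤ) (alternating-C n m) ⟩
  -1ℤ * (-1ℤ ℤ.^ n * δ n m)
    ≡⟨ ℤ.*-assoc -1ℤ (-1ℤ ℤ.^ n) (δ n m) ⟨
  -1ℤ ℤ.^ suc n * δ (suc n) (suc m)
    ∎
  where
  g₀ g₁ : ℕ → ℤ
  g₀ b = + (b C m)
  g₁ b = + (b C suc m)
  cancel : ∀ x y → x - (y + x) ≡ -1ℤ * y
  cancel = solve-∀

-- Sums of the Möbius function

∈-primeDivisors⁻ : ∀ {q n} .{{_ : NonZero n}} → q ∈ primeDivisors n → Prime q × q ∣ n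
∈-primeDivisors⁻ {n = n} q∈ = proj₂ (∈-filter⁻ (λ q → prime? q ×-dec q ∣? n) {xs = upTo (suc n)} q∈)

∈-primeDivisors⁺ : ∀ {q n} .{{_ : NonZero n}} → Prime q → q ∣ n → q ∈ primeDivisors n
∈-primeDivisors⁺ {n = n} pr q∣n = ∈-filter⁺ (λ q → prime? q ×-dec q ∣? n) (∈-upTo⁺ (s≤s (ℕ.∣⇒≤ q∣n))) (pr , q∣n)

primeDivisors-unique : ∀ n .{{_ : NonZero n}} → Unique (primeDivisors n)
primeDivisors-unique n = Unique.filter⁺ (λ q → prime? q ×-dec q ∣? n) (Unique.upTo⁺ (suc n))

μ-square : ∀ {p} → Prime p → ∀ n .{{_ : NonZero n}} → p ℕ.* p ∣ n → μ n ≡ 0ℤ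
μ-square {p} pr n p²∣n =
  cong (if_then 0ℤ else -1ℤ ℤ.^ length (primeDivisors n))
    (dec-true (any? (λ q → q ℕ.* q ∣? n) (primeDivisors n))
      (lose (∈-primeDivisors⁺ pr (ℕ.∣-trans (ℕ.m∣m*n p) p²∣n)) p²∣n))

∤⇒coprime : ∀ {p d} → Prime p → ¬ p ∣ d → Coprime d p
∤⇒coprime pr p∤d (i∣d , i∣p) with prime⇒irreducible pr i∣p
... | inj₁ i≡1  = i≡1
... | inj₂ refl = contradiction i∣d p∤d

prime-∣-prime : ∀ {p q} → Prime p → Prime q → p ∣ q → p ≡ q
prime-∣-prime prp prq p∣q with prime⇒irreducible prq p∣q
... | inj₁ p≡1 = contradiction p≡1 (ℕ.nonTrivial⇒≢1 {{prime⇒nonTrivial prp}})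
... | inj₂ p≡q = p≡q

module _ {p} (pr : Prime p) (e : ℕ) .{{_ : NonZero e}} .{{_ : NonZero (e ℕ.* p)}}
         (p∤e : ¬ p ∣ e) where

  -- Two lists without repetition and with the same members are permutations of each other. Equality
  -- may fail, as the right-hand list is increasing; `μ` only needs the length.
  primeDivisors-*-prime : p ∷ primeDivisors e ↭ primeDivisors (e ℕ.* p)
  primeDivisors-*-prime = ∼bag⇒↭ (unique∧set⇒bag
    (¬Any⇒All¬ _ (p∤e ∘ proj₂ ∘ ∈-primeDivisors⁻) ∷ primeDivisors-unique e)
    (primeDivisors-unique (e ℕ.* p))
    (mk⇔ to from))
    where
    to : ∀ {q} → q ∈ p ∷ primeDivisors e → q ∈ primeDivisors (e ℕ.* p)
    to (here refl) = ∈-primeDivisors⁺ pr (ℕ.n∣m*n e)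
    to (there q∈) with prq , q∣e ← ∈-primeDivisors⁻ q∈ =
      ∈-primeDivisors⁺ prq (ℕ.∣m⇒∣m*n p q∣e)
    from : ∀ {q} → q ∈ primeDivisors (e ℕ.* p) → q ∈ p ∷ primeDivisors e
    from {q} q∈ with prq , q∣ep ← ∈-primeDivisors⁻ q∈ with q ℕ.≟ p
    ... | yes refl = here refl
    ... | no  q≢p with euclidsLemma e p prq q∣ep
    ...   | inj₁ q∣e = there (∈-primeDivisors⁺ prq q∣e)
    ...   | inj₂ q∣p = contradiction (prime-∣-prime prq pr q∣p) q≢p

  -- For q ≠ p, a square q² dividing e p divides e. For q = p it would give p ∣ e, which is
  -- excluded.
  square-*-prime : Any (λ q → q ℕ.* q ∣ e ℕ.* p) (primeDivisors (e ℕ.* p)) ⇔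
                   Any (λ q → q ℕ.* q ∣ e) (primeDivisors e)
  square-*-prime = mk⇔ to from
    where
    to : Any (λ q → q ℕ.* q ∣ e ℕ.* p) (primeDivisors (e ℕ.* p)) →
         Any (λ q → q ℕ.* q ∣ e) (primeDivisors e)
    to any with q , q∈ , q²∣ep ← find any with prq , _ ← ∈-primeDivisors⁻ q∈ with q ℕ.≟ p
    ... | yes refl = contradiction (ℕ.*-cancelʳ-∣ p {{prime⇒nonZero pr}} q²∣ep) p∤e
    ... | no  q≢p  = lose (∈-primeDivisors⁺ prq (ℕ.∣-trans (ℕ.m∣m*n q) q²∣e)) q²∣e
      where
      q²∣e : q ℕ.* q ∣ e
      -- `q ^ 2` unfolds to `q * (q * 1)`, hence the rewriting by `*-identityʳ` here and below.
      q²∣e = subst (λ x → q ℕ.* x ∣ e) (ℕ.*-identityʳ q)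
        (prime-power-divisor prq 2 p e (λ q∣p → q≢p (prime-∣-prime prq pr q∣p))
          (subst₂ _∣_ (cong (q ℕ.*_) (sym (ℕ.*-identityʳ q))) (ℕ.*-comm e p) q²∣ep))
    from : Any (λ q → q ℕ.* q ∣ e) (primeDivisors e) →
           Any (λ q → q ℕ.* q ∣ e ℕ.* p) (primeDivisors (e ℕ.* p))
    from any with q , q∈ , q²∣e ← find any with prq , q∣e ← ∈-primeDivisors⁻ q∈ =
      lose (∈-primeDivisors⁺ prq (ℕ.∣m⇒∣m*n p q∣e)) (ℕ.∣m⇒∣m*n p q²∣e)

  -- The test for square factors has the same outcome for e p and e, and the one additional prime
  -- divisor flips the sign.
  μ-*-prime : μ (e ℕ.* p) ≡ - μ e
  μ-*-prime = begin
    μ (e ℕ.* p)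
      ≡⟨ cong₂ (λ b l → if b then 0ℤ else -1ℤ ℤ.^ l)
           (does-⇔ square-*-prime (any? (λ q → q ℕ.* q ∣? e ℕ.* p) (primeDivisors (e ℕ.* p)))
                                  (any? (λ q → q ℕ.* q ∣? e) (primeDivisors e)))
           (sym (↭-length primeDivisors-*-prime)) ⟩
    (if b then 0ℤ else -1ℤ * -1ℤ ℤ.^ length (primeDivisors e))
      ≡⟨ cong (if b then 0ℤ else_) (ℤ.-1*i≡-i (-1ℤ ℤ.^ length (primeDivisors e))) ⟩
    (if b then 0ℤ else - (-1ℤ ℤ.^ length (primeDivisors e)))
      ≡⟨ if-float -_ b ⟨
    - μ e
      ∎
    where
    b = does (any? (λ q → q ℕ.* q ∣? e) (primeDivisors e))

-- Defined for all d, with value 0 at d = 0, so that divisor sums become sums over an initial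
-- segment starting at 0, as in `∑<-multiples`.
μ[_∣_] : ℕ → ℕ → ℤ
μ[ zero    ∣ k ] = 0ℤ
μ[ d@(suc _) ∣ k ] = if does (d ∣? k) then μ d else 0ℤ

μ[]-∣ : ∀ {d k} .{{_ : NonZero d}} → d ∣ k → μ[ d ∣ k ] ≡ μ d
μ[]-∣ {d@(suc _)} {k} d∣k = cong (if_then μ d else 0ℤ) (dec-true (d ∣? k) d∣k)

μ[]-∤ : ∀ {d k} → ¬ d ∣ k → μ[ d ∣ k ] ≡ 0ℤ
μ[]-∤ {zero}      {k} d∤k = refl
μ[]-∤ {d@(suc _)} {k} d∤k = cong (if_then μ d else 0ℤ) (dec-false (d ∣? k) d∤k)

-- The divisors d prime to p and the divisors e p of k p cancel in pairs.
∑μ≡0 : ∀ {p} → Prime p → ∀ k .{{_ : NonZero k}} → ∑< (suc (k ℕ.* p)) μ[_∣ k ℕ.* p ] ≡ 0ℤ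
∑μ≡0 {p} pr k = begin
  ∑< (suc n) μ[_∣ n ]
    ≡⟨ ∑<-cong (suc n) (λ d _ → split d) ⟩
  ∑< (suc n) (λ d → A d + B d)
    ≡⟨ ∑<-distrib-+ (suc n) A B ⟩
  ∑< (suc n) A + ∑< (suc n) B
    ≡⟨ cong₂ _+_ (∑<-multiples p k A λ d p∤d → cong (if_then μ[ d ∣ n ] else 0ℤ) (dec-false (p ∣? d) p∤d))
                 (∑<-truncate (s≤s (ℕ.m≤m*n k p)) λ d k<d → B-vanishes d k<d) ⟩
  ∑< (suc k) (λ e → A (e ℕ.* p)) + ∑< (suc k) B
    ≡⟨ cong (_+ ∑< (suc k) B) (trans (∑<-cong (suc k) λ e _ → A-multiple e) (∑<-distrib-neg (suc k) B)) ⟩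
  - ∑< (suc k) B + ∑< (suc k) B
    ≡⟨ ℤ.+-inverseˡ (∑< (suc k) B) ⟩
  0ℤ
    ∎
  where
  instance
    _ = prime⇒nonZero pr
    _ = ℕ.m*n≢0 k p
  n = k ℕ.* p
  A B : ℕ → ℤ
  A d = if does (p ∣? d) then μ[ d ∣ n ] else 0ℤ
  B d = if does (p ∣? d) then 0ℤ else μ[ d ∣ k ]

  -- A divisor of k p that is prime to p divides k; this is why `B` refers to k and not to n.
  split : ∀ d → μ[ d ∣ n ] ≡ A d + B d
  split d with p ∣? d
  ... | yes _   = sym (ℤ.+-identityʳ μ[ d ∣ n ])
  ... | no  p∤d with d ∣? k
  ...   | yes d∣k = trans (trans (μ[]-∣ (ℕ.∣m⇒∣m*n p d∣k)) (sym (μ[]-∣ d∣k))) (sym (ℤ.+-identityˡ μ[ d ∣ k ]))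
    where instance _ = ℕ.≢-nonZero (λ { refl → p∤d (p ℕ.∣0) })
  ...   | no  d∤k = trans (trans (μ[]-∤ d∤n) (sym (μ[]-∤ d∤k))) (sym (ℤ.+-identityˡ μ[ d ∣ k ]))
    where
    d∤n : ¬ d ∣ n
    d∤n d∣n = d∤k (coprime-divisor (∤⇒coprime pr p∤d) (subst (d ∣_) (ℕ.*-comm k p) d∣n))

  B-vanishes : ∀ d → k < d → B d ≡ 0ℤ
  B-vanishes d k<d = trans (cong (if does (p ∣? d) then 0ℤ else_) (μ[]-∤ (ℕ.>⇒∤ k<d)))
                           (if-eta (does (p ∣? d)))

  A-multiple : ∀ e → A (e ℕ.* p) ≡ - B e
  A-multiple e = trans (cong (if_then μ[ e ℕ.* p ∣ n ] else 0ℤ) (dec-true (p ∣? e ℕ.* p) (ℕ.n∣m*n e))) μ[e*p]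
    where
    μ[e*p] : μ[ e ℕ.* p ∣ n ] ≡ - B e
    μ[e*p] with e ∣? k
    ... | no  e∤k = trans (μ[]-∤ (e∤k ∘ ℕ.*-cancelʳ-∣ p)) (sym (cong -_
      (trans (cong (if does (p ∣? e) then 0ℤ else_) (μ[]-∤ e∤k)) (if-eta (does (p ∣? e))))))
    ... | yes e∣k = trans (μ[]-∣ (ℕ.*-monoˡ-∣ p e∣k)) μ-case
      where
      instance
        _ = ℕ.≢-nonZero {e} (λ { refl → ℕ.≢-nonZero⁻¹ k (ℕ.0∣⇒≡0 e∣k) })
        _ = ℕ.m*n≢0 e p
      μ-case : μ (e ℕ.* p) ≡ - B e
      μ-case with p ∣? e
      -- Here `B e` is 0, and `μ (e * p)` vanishes because p² divides e p.
      ... | yes p∣e = μ-square pr (e ℕ.* p) (ℕ.*-monoˡ-∣ p p∣e)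
      ... | no  p∤e = trans (μ-*-prime pr e p∤e) (cong -_ (sym (μ[]-∣ e∣k)))

-- Valuations

n<m^n : ∀ {m} → 1 < m → ∀ n → n < m ^ n
n<m^n     1<m zero    = z<s
n<m^n {m} 1<m (suc n) = ℕ.≤-<-trans (n<m^n 1<m n) (ℕ.^-monoʳ-< m 1<m (ℕ.n<1+n n))

-- All entries of the filtered list have this property, and so does the default value 0 of `max`, as
-- p^0 = 1.
p^vℕ∣n : ∀ p n .{{_ : NonZero n}} → p ^ vℕ p n ∣ n
p^vℕ∣n p n = argmax-all id {P = λ k → p ^ k ∣ n} (ℕ.1∣ n) (all-filter (λ k → p ^ k ∣? n) (upTo n))

p^k∣n⇒k≤vℕ : ∀ {p k n} .{{_ : NonZero n}} → 1 < p → p ^ k ∣ n → k ≤ vℕ p n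
p^k∣n⇒k≤vℕ {p} {k} {n} 1<p pᵏ∣n = v≤max⁺ 0 _ (inj₂ (lose
  (∈-filter⁺ (λ k → p ^ k ∣? n) (∈-upTo⁺ (ℕ.<-≤-trans (n<m^n 1<p k) (ℕ.∣⇒≤ pᵏ∣n))) pᵏ∣n)
  ℕ.≤-refl))

p^k∣x⇒k≤v : ∀ {p k} x → 1 < p → p ^ k ∣ ∣ x ∣ → [ + k ] ≤⁺ v p x
p^k∣x⇒k≤v (+ 0)        1<p pᵏ∣x = _ ≤⁺⊤
p^k∣x⇒k≤v ℤ.+[1+ _ ]   1<p pᵏ∣x = ≤⁺[ ℤ.+≤+ (p^k∣n⇒k≤vℕ 1<p pᵏ∣x) ]
p^k∣x⇒k≤v ℤ.-[1+ _ ]   1<p pᵏ∣x = ≤⁺[ ℤ.+≤+ (p^k∣n⇒k≤vℕ 1<p pᵏ∣x) ]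

-- The bound for v_p(n) = 0.
-1≤v : ∀ p x → [ -1ℤ ] ≤⁺ v p x
-1≤v p (+ 0)        = _ ≤⁺⊤
-1≤v p ℤ.+[1+ _ ]   = ≤⁺[ ℤ.-≤+ ]
-1≤v p ℤ.-[1+ _ ]   = ≤⁺[ ℤ.-≤+ ]

-- The sum S modulo powers of p

-- Without the factor p², d absorbs at most one p: either p does not divide d, or d = c p with c
-- prime to p.
p^[1+j]∣d*N⇒p^j∣N : ∀ {p} → Prime p → ∀ j d N → ¬ p ℕ.* p ∣ d → p ^ suc j ∣ d ℕ.* N → p ^ j ∣ N
p^[1+j]∣d*N⇒p^j∣N {p} pr j d N p²∤d h with p ∣? d
... | no  p∤d = ℕ.∣-trans (ℕ.n∣m*n p) (prime-power-divisor pr (suc j) d N p∤d h)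
... | yes (divides-refl c) = prime-power-divisor pr j c N (p²∤d ∘ ℕ.*-monoˡ-∣ p)
  (ℕ.*-cancelˡ-∣ p {{prime⇒nonZero pr}} (subst (p ^ suc j ∣_) regroup h))
  where
  regroup : c ℕ.* p ℕ.* N ≡ p ℕ.* (c ℕ.* N)
  regroup = trans (cong (ℕ._* N) (ℕ.*-comm c p)) (ℕ.*-assoc p c N)

module _ {r : ℕ} (pr : Prime (suc r)) (2∤p : ¬ 2 ∣ suc r) where

  private
    p = suc r

  -- Put a = b p. As p is odd, (-1)^(b p) = (-1)^b, and C(n p, b p) may be replaced by C(n, b). What
  -- remains is `alternating-C`, whose sign (-1)^n cancels against the factor in front.
  ∑-multiples-mod : ∀ j n M → p ^ j ∣ n ℕ.* p →
    -1ℤ ℤ.^ (n ℕ.* p) *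
      ∑-multiples p (n ℕ.* p) (λ a → -1ℤ ℤ.^ a * + ((n ℕ.* p) C a) * + ((a / p) C M))
    ≡ δ n M ⟨mod + (p ^ j) ⟩
  ∑-multiples-mod j n M pʲ∣N =
    subst₂ (λ x y → -1ℤ ℤ.^ N * x ≡ y ⟨mod + (p ^ j) ⟩) (sym reindex) sign-cancels
      (*-mod (≡⇒mod (odd⇒[-1]^[m*n]≡[-1]^m n 2∤p)) (∑<-mod (suc n) λ b _ → term b))
    where
    N = n ℕ.* p
    f h : ℕ → ℤ
    f a = -1ℤ ℤ.^ a * + (N C a) * + ((a / p) C M)
    h a = if does (p ∣? a) then f a else 0ℤ
    reindex : ∑-multiples p N f ≡ ∑< (suc n) (λ b → h (b ℕ.* p))
    reindex = ∑<-multiples p n h λ a p∤a → cong (if_then f a else 0ℤ) (dec-false (p ∣? a) p∤a)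
    term : ∀ b → h (b ℕ.* p) ≡ -1ℤ ℤ.^ b * + (n C b) * + (b C M) ⟨mod + (p ^ j) ⟩
    term b = subst (λ x → x ≡ -1ℤ ℤ.^ b * + (n C b) * + (b C M) ⟨mod + (p ^ j) ⟩)
      (sym (cong (if_then f (b ℕ.* p) else 0ℤ) (dec-true (p ∣? b ℕ.* p) (ℕ.n∣m*n b))))
      (*-mod (*-mod (≡⇒mod (odd⇒[-1]^[m*n]≡[-1]^m b 2∤p)) (C[n*p,b*p]-mod pr 2∤p j n b pʲ∣N))
             (≡⇒mod (cong (λ x → + (x C M)) (m*n/n≡m b p))))
    sign-cancels : -1ℤ ℤ.^ n * alternating n (λ b → + (b C M)) ≡ δ n M
    sign-cancels = begin
      -1ℤ ℤ.^ n * alternating n (λ b → + (b C M)) ≡⟨ cong (_*_ (-1ℤ ℤ.^ n)) (alternating-C n M) ⟩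
      -1ℤ ℤ.^ n * (-1ℤ ℤ.^ n * δ n M)             ≡⟨ ℤ.*-assoc (-1ℤ ℤ.^ n) (-1ℤ ℤ.^ n) (δ n M) ⟨
      -1ℤ ℤ.^ n * -1ℤ ℤ.^ n * δ n M               ≡⟨ cong (_* δ n M) ([-1]^-square n) ⟩
      1ℤ * δ n M                                  ≡⟨ ℤ.*-identityˡ (δ n M) ⟩
      δ n M                                       ∎

  -- N and M stand for n / d and m / d. As variables they allow N to be matched with `n′ * p`.
  summand : (d N M : ℕ) .{{_ : NonZero d}} → ℤ
  summand d N M = μ d * -1ℤ ℤ.^ N *
    ∑-multiples p N (λ a → -1ℤ ℤ.^ a * + (N C a) * + ((a / p) C M))

  -- If p² ∣ d, both sides vanish with μ(d). Otherwise p^(j + 1) still divides N. The arguments of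
  -- `δ` are scaled by d and p to become n and m p, so that this factor is the same for all d.
  summand-mod : ∀ j d N M .{{_ : NonZero d}} → p ^ suc (suc j) ∣ N ℕ.* d →
                summand d N M ≡ μ d * δ (N ℕ.* d) (M ℕ.* d ℕ.* p) ⟨mod + (p ^ suc j) ⟩
  summand-mod j d N M pʲ∣n with p ℕ.* p ∣? d
  ... | yes p²∣d = ≡⇒mod (trans (cong (λ x → x * -1ℤ ℤ.^ N * t) μ≡0)
                                (sym (cong (_* δ (N ℕ.* d) (M ℕ.* d ℕ.* p)) μ≡0)))
    where
    μ≡0 = μ-square pr d p²∣d
    t = ∑-multiples p N (λ a → -1ℤ ℤ.^ a * + (N C a) * + ((a / p) C M))
  ... | no  p²∤d
    with pʲ∣N ← p^[1+j]∣d*N⇒p^j∣N pr (suc j) d N p²∤d (subst (p ^ suc (suc j) ∣_) (ℕ.*-comm N d) pʲ∣n)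
    -- The exponent j + 1 is positive, so N is a multiple of p; this is where v_p(n) ≥ 2 enters.
    with divides-refl n′ ← ℕ.∣-trans (ℕ.m∣m*n {p} (p ^ j)) pʲ∣N =
    subst₂ (λ x y → x ≡ μ d * y ⟨mod + (p ^ suc j) ⟩) (sym (ℤ.*-assoc (μ d) _ _)) δ≡δ
      (*-mod (≡⇒mod {x = μ d} refl) (∑-multiples-mod (suc j) n′ M pʲ∣N))
    where
    swap : M ℕ.* d ℕ.* p ≡ M ℕ.* p ℕ.* d
    swap = trans (ℕ.*-assoc M d p) (trans (cong (M ℕ.*_) (ℕ.*-comm d p)) (sym (ℕ.*-assoc M p d)))
    δ≡δ : δ n′ M ≡ δ (n′ ℕ.* p ℕ.* d) (M ℕ.* d ℕ.* p)
    δ≡δ = cong (if_then 1ℤ else 0ℤ) (does-⇔ (mk⇔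
      (λ n′≡M → trans (cong (λ x → x ℕ.* p ℕ.* d) n′≡M) (sym swap))
      (λ eq → ℕ.*-cancelʳ-≡ n′ M p (ℕ.*-cancelʳ-≡ (n′ ℕ.* p) (M ℕ.* p) d (trans eq swap))))
      (n′ ℕ.≟ M) (n′ ℕ.* p ℕ.* d ℕ.≟ M ℕ.* d ℕ.* p))

  -- Only n = m p needs an argument: then gcd(m, n) = m, and cancelling p from p^(j + 2) ∣ m p shows
  -- p ∣ m, so `∑μ≡0` applies.
  ∑μδ≡0 : ∀ m n .{{_ : NonZero m}} j → p ^ suc (suc j) ∣ n →
          ∑< (gcd m n) (λ i → μ[ suc i ∣ gcd m n ] * δ n (m ℕ.* p)) ≡ 0ℤ
  ∑μδ≡0 m n j pʲ∣n with n ℕ.≟ m ℕ.* p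
  ... | no  n≢mp = ∑<-zero (gcd m n) λ i _ →
    trans (cong (λ b → μ[ suc i ∣ gcd m n ] * (if b then 1ℤ else 0ℤ)) (dec-false (n ℕ.≟ m ℕ.* p) n≢mp))
          (ℤ.*-zeroʳ μ[ suc i ∣ gcd m n ])
  ... | yes refl with divides-refl k ← ℕ.∣-trans (ℕ.m∣m*n {p} (p ^ j)) (ℕ.*-cancelʳ-∣ {n = m} p
      (subst (_∣ m ℕ.* p) (ℕ.*-comm p (p ^ suc j)) pʲ∣n)) = begin
    ∑< (gcd m n) (λ i → μ[ suc i ∣ gcd m n ] * δ n n)
      ≡⟨ cong (λ g → ∑< g (λ i → μ[ suc i ∣ g ] * δ n n)) gcd≡m ⟩
    ∑< m (λ i → μ[ suc i ∣ m ] * δ n n)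
      ≡⟨ ∑<-cong m (λ i _ → trans (cong (λ b → μ[ suc i ∣ m ] * (if b then 1ℤ else 0ℤ)) (dec-true (n ℕ.≟ n) refl)) (ℤ.*-identityʳ μ[ suc i ∣ m ])) ⟩
    ∑< m (λ i → μ[ suc i ∣ m ])
      -- The index 0 is added; `μ[ 0 ∣ m ]` is 0 by definition.
      ≡⟨ ℤ.+-identityˡ (∑< m (λ i → μ[ suc i ∣ m ])) ⟨
    ∑< (suc m) μ[_∣ m ]
      ≡⟨ ∑μ≡0 pr k {{ℕ.m*n≢0⇒m≢0 k}} ⟩
    0ℤ
      ∎
    where
    gcd≡m : gcd m n ≡ m
    gcd≡m = ℕ.∣-antisym (gcd[m,n]∣m m n) (gcd-greatest ℕ.∣-refl (ℕ.m∣m*n p))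

  p^[1+j]∣S : ∀ m n .{{_ : NonZero m}} j → p ^ suc (suc j) ∣ n → p ^ suc j ∣ ∣ S p m n ∣
  p^[1+j]∣S m n j pʲ∣n = ∣⇒∣ᵤ (subst (+ (p ^ suc j) ∣ℤ_) (ℤ.+-identityʳ (S p m n))
    (divides-difference (subst (λ x → S p m n ≡ x ⟨mod + (p ^ suc j) ⟩) (∑μδ≡0 m n j pʲ∣n)
      (∑<-mod (gcd m n) λ i _ → term (suc i)))))
    where
    term : ∀ d .{{_ : NonZero d}} →
           (if does (d ∣? gcd m n) then summand d (n / d) (m / d) else 0ℤ)
           ≡ μ[ d ∣ gcd m n ] * δ n (m ℕ.* p) ⟨mod + (p ^ suc j) ⟩
    -- Matching on `suc _` lets `μ[ d ∣ _ ]` unfold. For a common divisor d the products (n / d) d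
    -- and (m / d) d are n and m.
    term d@(suc _) = if-mod (d ∣? gcd m n) λ d∣g →
      let n/d*d≡n = m/n*n≡m (ℕ.∣-trans d∣g (gcd[m,n]∣n m n))
          m/d*d≡m = m/n*n≡m (ℕ.∣-trans d∣g (gcd[m,n]∣m m n))
      in subst₂ (λ x y → summand d (n / d) (m / d) ≡ μ d * δ x (y ℕ.* p) ⟨mod + (p ^ suc j) ⟩)
           n/d*d≡n m/d*d≡m
           (summand-mod j d (n / d) (m / d) (subst (p ^ suc (suc j) ∣_) (sym n/d*d≡n) pʲ∣n))

corollary1p6 : (p m n : ℕ) .{{_ : NonZero m}} .{{_ : NonZero n}}
    (pr : Prime p) → ¬ (2 ∣ p) →
    ([ + vℕ p n - 1ℤ ] ≤⁺ v p (S p m n {{prime⇒nonZero pr}}))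
    × (2 ≤ vℕ p n → S p m n {{prime⇒nonZero pr}} ≡ 0ℤ [mod p ^ (vℕ p n ∸ 1) ])
corollary1p6 zero        m n pr 2∤p = contradiction refl (ℕ.≢-nonZero⁻¹ 0 {{prime⇒nonZero pr}})
corollary1p6 p@(suc _)   m n pr 2∤p = bounds (vℕ p n) (p^vℕ∣n p n)
  where
  -- The valuation is generalised to any k with p^k ∣ n, so that the cases 0, 1 and at least 2 can
  -- be matched on.
  bounds : ∀ k → p ^ k ∣ n →
           ([ + k - 1ℤ ] ≤⁺ v p (S p m n)) × (2 ≤ k → S p m n ≡ 0ℤ [mod p ^ (k ∸ 1) ])
  bounds zero          _    = -1≤v p (S p m n) , λ ()
  -- The bound is 0 and follows from p^0 ∣ S.
  bounds (suc zero)    _    = p^k∣x⇒k≤v (S p m n) 1<p (ℕ.1∣ _) , λ { (s≤s ()) }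
    where 1<p = ℕ.nonTrivial⇒n>1 p {{prime⇒nonTrivial pr}}
  bounds (suc (suc j)) pᵏ∣n =
    p^k∣x⇒k≤v (S p m n) (ℕ.nonTrivial⇒n>1 p {{prime⇒nonTrivial pr}}) pʲ∣S ,
    λ _ → subst (λ x → p ^ suc j ∣ ∣ x ∣) (sym (ℤ.+-identityʳ (S p m n))) pʲ∣S
    where pʲ∣S = p^[1+j]∣S pr 2∤p m n j pᵏ∣n
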